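{- Let $\mathbb{T}$ be an algebraic theory. Then the variety $\mathbb{T}\text{ - }\mathrm{Mod}$ of $\mathbb{T}$-models is a cartesian closed category if and only if $\mathbb{T}$ is hyperaffine--unary, i.e., if and only if for every set $I$ and every operation $t \in T(I)$ there exist a unique hyperaffine operation $h \in T(I)$ and a unique unary operation $m \in T(1)$ (uniqueness being that of the pair $(h,m)$) such that $t = h(\lambda i.\, m(x_i))$.
   Context: Notation: for sets $I,J$, $J^I$ is the set of functions $I \to J$; $u_i$ is the value of $u\in J^I$ at $i$; $\lambda i.\, t_i$ is the function $i \mapsto t_i$. A natural number $n$ is identified with $\{1,\dots,n\}$. An algebraic theory $\mathbb{T}$ comprises: for each set $I$, a set $T(I)$ (the operations of arity $I$); for each set $I$ and $i\in I$, an element $\pi_i \in T(I)$ (the $i$th projection); and for all sets $I,J$, a substitution function $T(I)\times T(J)^I \to T(J)$, $(t,u)\mapsto t(u)$; subject to: $t(\lambda i.\,\pi_i)=t$ for $t \in T(I)$; $\pi_i(u)=u_i$ for $u\in T(J)^I$, $i \in I$; and $(t(u))(v) = t(\lambda i.\, u_i(v))$ for $t\in T(I)$, $u\in T(J)^I$, $v\in T(K)^J$. Operations in $T(1)$ are called unary. Variable notation: equations in variables $x, y, x_i, x_{ij},\dots$ are read as universally quantified over all sets $K$ and all elements $x,y,x_i,x_{ij},\dots$ of $T(K)$ (equivalently, as the equation obtained by substituting distinct projections for distinct variables). E.g. "$t = h(\lambda i.\, m(x_i))$" means that $t(x) = h(\lambda i.\, m(x_i))$ for all families $x$. A model of $\mathbb{T}$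 is a (possibly empty) set $X$ with, for each set $I$, a function $T(I)\times X^I\to X$, $(t,x)\mapsto [\![t]\!](x)$, such that $[\![\pi_i]\!](x)=x_i$ and $[\![t(u)]\!](x)=[\![t]\!](\lambda i.\,[\![u_i]\!](x))$. Homomorphisms of models are functions $f$ with $f([\![t]\!](x)) = [\![t]\!](\lambda i.\, f(x_i))$. $\mathbb{T}\text{ - }\mathrm{Mod}$ is the category of models and homomorphisms. An operation $t \in T(I)$ is affine if $t(\lambda i.\, x) = x$ in $T(1)$, and hyperaffine if in addition $t(\lambda i.\, t(\lambda j.\, x_{ij})) = t(\lambda i.\, x_{ii})$ in $T(I\times I)$. -}

module Defs where

open import Level using (Level; _⊔_; suc)
open import Data.Product using (_×_; _,_; ∃!)
open import Data.Product.Relation.Binary.Pointwise.NonDependent using (_×ₛ_)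
open import Data.Unit.Polymorphic using (tt)
import Data.Unit.Polymorphic.Properties as Unit
open import Function.Bundles using (Func; _⟨$⟩_)
import Function.Construct.Composition as Composition
import Function.Construct.Constant as Constant
import Function.Construct.Identity as Identity
open import Function.Relation.Binary.Setoid.Equality using (_⇨_)
open import Relation.Binary.Bundles using (Setoid)

open Setoid using (Carrier)

-- Sets are read as setoids throughout: arities, sets of operations and
-- carriers of models all range over the same collection SET ℓ, and the set of
-- functions J^I is the setoid I ⇨ J of equality-preserving functions up to
-- pointwise equality.

SET : (ℓ : Level) → Set (suc ℓ)
SET ℓ = Setoid ℓ ℓ

𝟙 : ∀ {ℓ} → SET ℓ
𝟙 {ℓ} = Unit.≡-setoid ℓ

const : ∀ {ℓ} {I X : SET ℓ} → Carrier X → Func I X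
const {I = I} {X} = Constant.function I X

record Theory (ℓ : Level) : Set (suc ℓ) where
  field
    T       : SET ℓ → SET ℓ
    proj    : (I : SET ℓ) → Func I (T I)
    substFn : (I J : SET ℓ) → Func (T I ×ₛ (I ⇨ T J)) (T J)

  Op : SET ℓ → Set ℓ
  Op I = Carrier (T I)

  infix 4 _≈_
  _≈_ : ∀ {I} → Op I → Op I → Set ℓ
  _≈_ {I} = Setoid._≈_ (T I)

  π : ∀ {I} → Carrier I → Op I
  π {I} i = proj I ⟨$⟩ i

  infixl 9 _⟪_⟫
  _⟪_⟫ : ∀ {I J} → Op I → Func I (T J) → Op J
  _⟪_⟫ {I} {J} t u = substFn I J ⟨$⟩ (t , u)

  ⟪⟫-cong : ∀ {I J} {t t′ : Op I} {u u′ : Func I (T J)} →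
            t ≈ t′ → (∀ i → u ⟨$⟩ i ≈ u′ ⟨$⟩ i) → t ⟪ u ⟫ ≈ t′ ⟪ u′ ⟫
  ⟪⟫-cong {I} {J} {t} {t′} {u} {u′} p q =
    Func.cong (substFn I J) {t , u} {t′ , u′} (p , q)

  -- The family λ i. uᵢ(v).
  infixl 9 _⟪_⟫ᶠ
  _⟪_⟫ᶠ : ∀ {I J K : SET ℓ} → Func I (T J) → Func J (T K) → Func I (T K)
  _⟪_⟫ᶠ {K = K} u v = record
    { to   = λ i → (u ⟨$⟩ i) ⟪ v ⟫
    ; cong = λ i≈j → ⟪⟫-cong (Func.cong u i≈j) (λ j → Setoid.refl (T K))
    }

  field
    subst-proj  : ∀ {I} (t : Op I) → t ⟪ proj I ⟫ ≈ t
    proj-subst  : ∀ {I J} (i : Carrier I) (u : Func I (T J)) →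
                  π i ⟪ u ⟫ ≈ u ⟨$⟩ i
    subst-subst : ∀ {I J K} (t : Op I) (u : Func I (T J)) (v : Func J (T K)) →
                  t ⟪ u ⟫ ⟪ v ⟫ ≈ t ⟪ u ⟪ v ⟫ᶠ ⟫

module _ {ℓ} (𝕋 : Theory ℓ) where
  open Theory 𝕋

  -- Equations located in T(𝟙) and T(I × I) are stated at the generic variables
  -- x = π tt and x_{ij} = π (i , j).
  IsAffine : ∀ {I} → Op I → Set ℓ
  IsAffine t = t ⟪ const (π {𝟙} tt) ⟫ ≈ π {𝟙} tt

  module _ {I : SET ℓ} where

    -- The family λ j. x_{ij} of variables, for fixed i.
    row : Carrier I → Func I (T (I ×ₛ I))
    row i = record
      { to   = λ j → π {I ×ₛ I} (i , j)
      ; cong = λ j≈j′ → Func.cong (proj (I ×ₛ I)) (Setoid.refl I , j≈j′)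
      }

    -- The family λ i. t(λ j. x_{ij}).
    rows : Op I → Func I (T (I ×ₛ I))
    rows t = record
      { to   = λ i → t ⟪ row i ⟫
      ; cong = λ i≈i′ → ⟪⟫-cong (Setoid.refl (T I))
                 (λ j → Func.cong (proj (I ×ₛ I)) (i≈i′ , Setoid.refl I))
      }

    -- The family λ i. x_{ii}.
    diagonal : Func I (T (I ×ₛ I))
    diagonal = record
      { to   = λ i → π {I ×ₛ I} (i , i)
      ; cong = λ i≈i′ → Func.cong (proj (I ×ₛ I)) (i≈i′ , i≈i′)
      }

    IsHyperaffine : Op I → Set ℓ
    IsHyperaffine t = IsAffine t × (t ⟪ rows t ⟫ ≈ t ⟪ diagonal ⟫)

  -- The family λ i. m(xᵢ), for a unary operation m.
  unary : ∀ {I K : SET ℓ} → Op 𝟙 → Func I (T K) → Func I (T K)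
  unary m x = record
    { to   = λ i → m ⟪ const (x ⟨$⟩ i) ⟫
    ; cong = λ i≈j → ⟪⟫-cong (Setoid.refl (T 𝟙)) (λ _ → Func.cong x i≈j)
    }

  -- t = h(λ i. m(xᵢ)), the variables ranging over all elements of all T(K).
  Decomposes : ∀ {I} → Op I → Op I → Op 𝟙 → Set (suc ℓ)
  Decomposes {I} t h m =
    ∀ (K : SET ℓ) (x : Func I (T K)) → t ⟪ x ⟫ ≈ h ⟪ unary m x ⟫

  IsHyperaffineUnary : Set (suc ℓ)
  IsHyperaffineUnary =
    ∀ (I : SET ℓ) (t : Op I) →
    ∃! (Setoid._≈_ (T I ×ₛ T 𝟙))
       (λ (h , m) → IsHyperaffine h × Decomposes t h m)

record Category (o m e : Level) : Set (suc (o ⊔ m ⊔ e)) where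
  infix  4 _≈_
  infixr 9 _∘_
  field
    Obj : Set o
    Hom : Obj → Obj → Setoid m e

  infix 4 _⟶_
  _⟶_ : Obj → Obj → Set m
  A ⟶ B = Carrier (Hom A B)

  _≈_ : ∀ {A B} → A ⟶ B → A ⟶ B → Set e
  _≈_ {A} {B} = Setoid._≈_ (Hom A B)

  field
    id  : ∀ {A} → A ⟶ A
    _∘_ : ∀ {A B C} → B ⟶ C → A ⟶ B → A ⟶ C

    ∘-cong    : ∀ {A B C} {g g′ : B ⟶ C} {f f′ : A ⟶ B} →
                g ≈ g′ → f ≈ f′ → g ∘ f ≈ g′ ∘ f′
    identityˡ : ∀ {A B} (f : A ⟶ B) → id ∘ f ≈ f
    identityʳ : ∀ {A B} (f : A ⟶ B) → f ∘ id ≈ f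
    assoc     : ∀ {A B C D} (h : C ⟶ D) (g : B ⟶ C) (f : A ⟶ B) →
                (h ∘ g) ∘ f ≈ h ∘ (g ∘ f)

module _ {o m e} (𝒞 : Category o m e) where
  open Category 𝒞

  record Terminal : Set (o ⊔ m ⊔ e) where
    field
      one      : Obj
      !        : ∀ A → A ⟶ one
      !-unique : ∀ {A} (f : A ⟶ one) → f ≈ ! A

  record Product (A B : Obj) : Set (o ⊔ m ⊔ e) where
    field
      A×B    : Obj
      π₁     : A×B ⟶ A
      π₂     : A×B ⟶ B
      ⟨_,_⟩  : ∀ {C} → C ⟶ A → C ⟶ B → C ⟶ A×B
      π₁-β   : ∀ {C} (f : C ⟶ A) (g : C ⟶ B) → π₁ ∘ ⟨ f , g ⟩ ≈ f
      π₂-β   : ∀ {C} (f : C ⟶ A) (g : C ⟶ B) → π₂ ∘ ⟨ f , g ⟩ ≈ g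
      unique : ∀ {C} (f : C ⟶ A) (g : C ⟶ B) (k : C ⟶ A×B) →
               π₁ ∘ k ≈ f → π₂ ∘ k ≈ g → k ≈ ⟨ f , g ⟩

  module _ (product : ∀ A B → Product A B) where

    infixr 7 _⊗_
    _⊗_ : Obj → Obj → Obj
    A ⊗ B = Product.A×B (product A B)

    _⊗id : ∀ {A A′ B} → A ⟶ A′ → A ⊗ B ⟶ A′ ⊗ B
    _⊗id {A} {A′} {B} f = Product.⟨_,_⟩ (product A′ B)
      (f ∘ Product.π₁ (product A B)) (Product.π₂ (product A B))

    record Exponential (A B : Obj) : Set (o ⊔ m ⊔ e) where
      field
        B^A    : Obj
        eval   : B^A ⊗ A ⟶ B
        curry  : ∀ {C} → C ⊗ A ⟶ B → C ⟶ B^A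
        β      : ∀ {C} (f : C ⊗ A ⟶ B) → eval ∘ (curry f ⊗id) ≈ f
        unique : ∀ {C} (f : C ⊗ A ⟶ B) (k : C ⟶ B^A) →
                 eval ∘ (k ⊗id) ≈ f → k ≈ curry f

  record CartesianClosed : Set (o ⊔ m ⊔ e) where
    field
      terminal    : Terminal
      product     : ∀ A B → Product A B
      exponential : ∀ A B → Exponential product A B

module _ {ℓ} (𝕋 : Theory ℓ) where
  open Theory 𝕋 hiding (_≈_)

  record Model : Set (suc ℓ) where
    field
      X     : SET ℓ
      actFn : (I : SET ℓ) → Func (T I ×ₛ (I ⇨ X)) X

    open Setoid X using (_≈_) public

    ⟦_⟧ : ∀ {I} → Op I → Func I X → Carrier X
    ⟦_⟧ {I} t x = actFn I ⟨$⟩ (t , x)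

    ⟦⟧-cong : ∀ {I} {t t′ : Op I} {x x′ : Func I X} →
              Setoid._≈_ (T I) t t′ → (∀ i → x ⟨$⟩ i ≈ x′ ⟨$⟩ i) →
              ⟦ t ⟧ x ≈ ⟦ t′ ⟧ x′
    ⟦⟧-cong {I} {t} {t′} {x} {x′} p q =
      Func.cong (actFn I) {t , x} {t′ , x′} (p , q)

    -- The family λ i. ⟦uᵢ⟧(x).
    ⟦_⟧ᶠ : ∀ {I J : SET ℓ} → Func I (T J) → Func J X → Func I X
    ⟦ u ⟧ᶠ x = record
      { to   = λ i → ⟦ u ⟨$⟩ i ⟧ x
      ; cong = λ i≈j → ⟦⟧-cong (Func.cong u i≈j) (λ j → Setoid.refl X)
      }

    field
      ⟦proj⟧  : ∀ {I} (i : Carrier I) (x : Func I X) → ⟦ π i ⟧ x ≈ x ⟨$⟩ i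
      ⟦subst⟧ : ∀ {I J} (t : Op I) (u : Func I (T J)) (x : Func J X) →
                ⟦ t ⟪ u ⟫ ⟧ x ≈ ⟦ t ⟧ (⟦ u ⟧ᶠ x)

  record Homomorphism (M N : Model) : Set (suc ℓ) where
    private
      module M = Model M
      module N = Model N
    field
      fun       : Func M.X N.X
      preserves : ∀ {I} (t : Op I) (x : Func I M.X) →
                  (fun ⟨$⟩ M.⟦ t ⟧ x) N.≈ N.⟦ t ⟧ (Composition.function x fun)

  open Homomorphism

  HomSetoid : Model → Model → Setoid (suc ℓ) ℓ
  HomSetoid M N = record
    { Carrier       = Homomorphism M N
    ; _≈_           = λ f g → ∀ x → (fun f ⟨$⟩ x) N.≈ (fun g ⟨$⟩ x)
    ; isEquivalence = record
      { refl  = λ x → Setoid.refl N.X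
      ; sym   = λ p x → Setoid.sym N.X (p x)
      ; trans = λ p q x → Setoid.trans N.X (p x) (q x)
      }
    }
    where module N = Model N

  idHom : ∀ {M} → Homomorphism M M
  idHom {M} = record
    { fun       = Identity.function (Model.X M)
    ; preserves = λ {I} t x → Model.⟦⟧-cong M (Setoid.refl (T I))
                            (λ i → Setoid.refl (Model.X M))
    }

  compHom : ∀ {L M N} → Homomorphism M N → Homomorphism L M → Homomorphism L N
  compHom {L} {M} {N} g f = record
    { fun       = Composition.function (fun f) (fun g)
    ; preserves = λ t x → Setoid.trans (Model.X N)
                            (Func.cong (fun g) (preserves f t x))
                            (preserves g t (Composition.function x (fun f)))
    }

  Mod : Category (suc ℓ) (suc ℓ) ℓ
  Mod = record
    { Obj       = Model
    ; Hom       = HomSetoid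
    ; id        = idHom
    ; _∘_       = compHom
    ; ∘-cong    = λ {_} {_} {N} {_} {g′} {f} g≈g′ f≈f′ x →
                    Setoid.trans (Model.X N) (g≈g′ (fun f ⟨$⟩ x))
                      (Func.cong (fun g′) (f≈f′ x))
    ; identityˡ = λ {_} {N} f x → Setoid.refl (Model.X N)
    ; identityʳ = λ {_} {N} f x → Setoid.refl (Model.X N)
    ; assoc     = λ {_} {_} {_} {N} h g f x → Setoid.refl (Model.X N)
    }

{-# OPTIONS --safe #-}

-- Write F I for the free model T(I). Both directions turn on the statement that
-- F I × A is the I-fold copower of F 1 × A.
--
-- If A is exponentiable this holds because F I is the I-fold copower of F 1 and
-- − × A is a left adjoint. Hence there is a homomorphism ψ : F I × F 1 → F I with
-- ψ(m(xᵢ), n) = n(xᵢ), and t = h(λ i. m(xᵢ)) with h = ψ(t, x), m = t(λ i. x).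
-- The homomorphism χ : F I × F I → F (I × I) with χ(m(xᵢ), s) = s(λ j. x_{ij})
-- satisfies χ(s, s) = s(λ i. x_{ii}), and χ(h, s) = h(λ i. s(λ j. x_{ij})) for
-- affine h; so affine operations are hyperaffine.
--
-- Conversely, decompositions t = h(λ i. m(xᵢ)) extend homomorphisms
-- φᵢ : F 1 × A → B to F I × A → B by (t, a) ↦ h(λ i. φᵢ(m, a)), and B^A is the
-- set of homomorphisms F 1 × A → B, on which t acts by sending φ to the
-- composite of this extension with n ↦ n(t).
module Submission where

open import Defs
open import Function.Bundles using (_⇔_; mk⇔; Func; _⟨$⟩_)
import Function.Construct.Composition as Composition
import Function.Construct.Identity as Identity
open import Data.Product using (Σ; _×_; _,_; proj₁; proj₂)
open import Data.Product.Relation.Binary.Pointwise.NonDependent using (_×ₛ_)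
open import Data.Unit.Polymorphic using (tt)
open import Relation.Binary.Bundles using (Setoid)
open import Relation.Binary.Reasoning.MultiSetoid

open Setoid using (Carrier)

-- Doubly indexed families.

module _ {ℓ} {I J X : SET ℓ} where

  slice : Func (I ×ₛ J) X → Carrier I → Func J X
  slice x i = record
    { to   = λ j → x ⟨$⟩ (i , j)
    ; cong = λ p → Func.cong x (Setoid.refl I , p)
    }

  transpose : Func (I ×ₛ J) X → Func (J ×ₛ I) X
  transpose x = record
    { to   = λ (j , i) → x ⟨$⟩ (i , j)
    ; cong = λ (p , q) → Func.cong x (q , p)
    }

-- Exponentials and the choice of binary products.

module _ {o m e} (𝒞 : Category o m e) where
  open Category 𝒞

  private
    infixr 4 _∙_
    _∙_ : ∀ {A B} {f g h : A ⟶ B} → f ≈ g → g ≈ h → f ≈ h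
    _∙_ {A} {B} = Setoid.trans (Hom A B)

    flip : ∀ {A B} {f g : A ⟶ B} → f ≈ g → g ≈ f
    flip {A} {B} = Setoid.sym (Hom A B)

    same : ∀ {A B} {f : A ⟶ B} → f ≈ f
    same {A} {B} = Setoid.refl (Hom A B)

  module ProductProperties {A B} (P : Product 𝒞 A B) where
    open Product P

    jointly-monic : ∀ {C} {f g : C ⟶ A×B} → π₁ ∘ f ≈ π₁ ∘ g → π₂ ∘ f ≈ π₂ ∘ g → f ≈ g
    jointly-monic {g = g} p q =
      unique (π₁ ∘ g) (π₂ ∘ g) _ p q ∙ flip (unique _ _ g same same)

  module _ (P Q : ∀ A B → Product 𝒞 A B) where
    private
      module P A B = Product (P A B)
      module Q A B = Product (Q A B)

      compare : ∀ {A B} → Q.A×B A B ⟶ P.A×B A B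
      compare {A} {B} = P.⟨_,_⟩ A B (Q.π₁ A B) (Q.π₂ A B)

      compare⁻¹ : ∀ {A B} → P.A×B A B ⟶ Q.A×B A B
      compare⁻¹ {A} {B} = Q.⟨_,_⟩ A B (P.π₁ A B) (P.π₂ A B)

      compare∘compare⁻¹ : ∀ {A B} → compare {A} {B} ∘ compare⁻¹ ≈ id
      compare∘compare⁻¹ {A} {B} = ProductProperties.jointly-monic (P A B)
        (flip (assoc _ _ _) ∙ ∘-cong (P.π₁-β _ _ _ _) same ∙ Q.π₁-β _ _ _ _ ∙ flip (identityʳ _))
        (flip (assoc _ _ _) ∙ ∘-cong (P.π₂-β _ _ _ _) same ∙ Q.π₂-β _ _ _ _ ∙ flip (identityʳ _))

      compare⁻¹∘compare : ∀ {A B} → compare⁻¹ {A} {B} ∘ compare ≈ id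
      compare⁻¹∘compare {A} {B} = ProductProperties.jointly-monic (Q A B)
        (flip (assoc _ _ _) ∙ ∘-cong (Q.π₁-β _ _ _ _) same ∙ P.π₁-β _ _ _ _ ∙ flip (identityʳ _))
        (flip (assoc _ _ _) ∙ ∘-cong (Q.π₂-β _ _ _ _) same ∙ P.π₂-β _ _ _ _ ∙ flip (identityʳ _))

      compare-natural : ∀ {A A′ B} (f : A ⟶ A′) →
        compare ∘ _⊗id 𝒞 Q {B = B} f ≈ _⊗id 𝒞 P f ∘ compare
      compare-natural {A} {A′} {B} f = ProductProperties.jointly-monic (P A′ B)
        (flip (assoc _ _ _) ∙ ∘-cong (P.π₁-β _ _ _ _) same ∙ Q.π₁-β _ _ _ _
          ∙ ∘-cong same (flip (P.π₁-β _ _ _ _)) ∙ flip (assoc _ _ _)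
          ∙ ∘-cong (flip (P.π₁-β _ _ _ _)) same ∙ assoc _ _ _)
        (flip (assoc _ _ _) ∙ ∘-cong (P.π₂-β _ _ _ _) same ∙ Q.π₂-β _ _ _ _
          ∙ flip (P.π₂-β _ _ _ _)
          ∙ ∘-cong (flip (P.π₂-β _ _ _ _)) same ∙ assoc _ _ _)

    -- `CartesianClosed` carries an arbitrary choice of products, while the main argument computes
    -- with the pairs of `productModel`. The canonical isomorphism `compare`, natural in the first
    -- factor, transports the exponentials.
    changeProduct : ∀ {A B} → Exponential 𝒞 P A B → Exponential 𝒞 Q A B
    changeProduct E = record
      { B^A    = B^A
      ; eval   = eval ∘ compare
      ; curry  = λ f → curry (f ∘ compare⁻¹)
      ; β      = λ f → assoc _ _ _ ∙ ∘-cong same (compare-natural _) ∙ flip (assoc _ _ _)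
                   ∙ ∘-cong (β _) same ∙ assoc _ _ _
                   ∙ ∘-cong same compare⁻¹∘compare ∙ identityʳ f
      ; unique = λ f k p → unique _ k
                   (flip (identityʳ _) ∙ ∘-cong same (flip compare∘compare⁻¹)
                     ∙ flip (assoc _ _ _) ∙ ∘-cong
                       (assoc _ _ _ ∙ ∘-cong same (flip (compare-natural k)) ∙ flip (assoc _ _ _) ∙ p)
                       same)
      }
      where open Exponential E

module _ {ℓ} {𝕋 : Theory ℓ} where
  open Theory 𝕋
  open Homomorphism

  -- Models

  module ModelProperties (M : Model 𝕋) where
    open Model M using (X; ⟦_⟧; ⟦_⟧ᶠ; ⟦⟧-cong; ⟦proj⟧; ⟦subst⟧)
    private
      module X = Setoid X
      _≋_ : Carrier X → Carrier X → Set ℓ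
      _≋_ = Model._≈_ M

    ⟦_⟧₁ : ∀ {I : SET ℓ} → Op 𝟙 → Func I X → Func I X
    ⟦ m ⟧₁ x = record
      { to   = λ i → ⟦ m ⟧ (const (x ⟨$⟩ i))
      ; cong = λ p → ⟦⟧-cong (Setoid.refl (T 𝟙)) (λ _ → Func.cong x p)
      }

    ⟦_⟧₂ : ∀ {I J : SET ℓ} → Func I (T J) → Func (I ×ₛ J) X → Func I X
    ⟦_⟧₂ {J = J} t x = record
      { to   = λ i → ⟦ t ⟨$⟩ i ⟧ (slice x i)
      ; cong = λ p → ⟦⟧-cong (Func.cong t p) (λ j → Func.cong x (p , Setoid.refl J))
      }

    ⟦⟧-congˡ : ∀ {I} {t t′ : Op I} {x : Func I X} → t ≈ t′ → ⟦ t ⟧ x ≋ ⟦ t′ ⟧ x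
    ⟦⟧-congˡ p = ⟦⟧-cong p (λ _ → X.refl)

    ⟦⟧-congʳ : ∀ {I} {t : Op I} {x x′ : Func I X} →
               (∀ i → (x ⟨$⟩ i) ≋ (x′ ⟨$⟩ i)) → ⟦ t ⟧ x ≋ ⟦ t ⟧ x′
    ⟦⟧-congʳ {I} p = ⟦⟧-cong (Setoid.refl (T I)) p

    -- An equation between operations, given at the generic variables, holds at all elements of
    -- every model by interpreting both sides. The next two lemmas follow the same pattern.
    ⟦affine⟧ : ∀ {I} {t : Op I} → IsAffine 𝕋 t → ∀ x → ⟦ t ⟧ (const x) ≋ x
    ⟦affine⟧ {I} {t} aff x = begin⟨ X ⟩
      ⟦ t ⟧ (const x)                     ≈⟨ ⟦⟧-congʳ (λ _ → ⟦proj⟧ tt (const x)) ⟨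
      ⟦ t ⟧ (⟦ const (π {𝟙} tt) ⟧ᶠ (const x)) ≈⟨ ⟦subst⟧ t _ _ ⟨
      ⟦ t ⟪ const (π {𝟙} tt) ⟫ ⟧ (const x)    ≈⟨ ⟦⟧-congˡ aff ⟩
      ⟦ π {𝟙} tt ⟧ (const x)                  ≈⟨ ⟦proj⟧ tt _ ⟩
      x                                       ∎

    ⟦hyperaffine⟧ : ∀ {I} {t : Op I} → IsHyperaffine 𝕋 t → (x : Func (I ×ₛ I) X) →
                    ⟦ t ⟧ (⟦ const t ⟧₂ x) ≋ ⟦ t ⟧ (⟦ diagonal 𝕋 ⟧ᶠ x)
    ⟦hyperaffine⟧ {I} {t} (_ , hyp) x = begin⟨ X ⟩
      ⟦ t ⟧ (⟦ const t ⟧₂ x)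
        ≈⟨ ⟦⟧-congʳ (λ i → X.trans (⟦subst⟧ t _ x) (⟦⟧-congʳ (λ j → ⟦proj⟧ (i , j) x))) ⟨
      ⟦ t ⟧ (⟦ rows 𝕋 t ⟧ᶠ x)      ≈⟨ ⟦subst⟧ t _ x ⟨
      ⟦ t ⟪ rows 𝕋 t ⟫ ⟧ x          ≈⟨ ⟦⟧-congˡ hyp ⟩
      ⟦ t ⟪ diagonal 𝕋 ⟫ ⟧ x        ≈⟨ ⟦subst⟧ t _ x ⟩
      ⟦ t ⟧ (⟦ diagonal 𝕋 ⟧ᶠ x)    ∎

    ⟦decomposition⟧ : ∀ {I} {t h : Op I} {m} → t ≈ h ⟪ unary 𝕋 m (proj I) ⟫ →
                      (x : Func I X) → ⟦ t ⟧ x ≋ ⟦ h ⟧ (⟦ m ⟧₁ x)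
    ⟦decomposition⟧ {I} {t} {h} {m} dec x = begin⟨ X ⟩
      ⟦ t ⟧ x                              ≈⟨ ⟦⟧-congˡ dec ⟩
      ⟦ h ⟪ unary 𝕋 m (proj I) ⟫ ⟧ x       ≈⟨ ⟦subst⟧ h _ x ⟩
      ⟦ h ⟧ (⟦ unary 𝕋 m (proj I) ⟧ᶠ x)
        ≈⟨ ⟦⟧-congʳ (λ i → X.trans (⟦subst⟧ m _ x) (⟦⟧-congʳ (λ _ → ⟦proj⟧ i x))) ⟩
      ⟦ h ⟧ (⟦ m ⟧₁ x)                     ∎

    -- Renaming variables along `x` turns an operation of any arity into one of arity `X`. This is
    -- what lets `smallHom` test preservation at a single arity.
    ⟦reindex⟧ : ∀ {I} (t : Op I) (x : Func I X) →
                ⟦ t ⟪ Composition.function x (proj X) ⟫ ⟧ (Identity.function X) ≋ ⟦ t ⟧ x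
    ⟦reindex⟧ t x = X.trans (⟦subst⟧ t _ _) (⟦⟧-congʳ (λ i → ⟦proj⟧ (x ⟨$⟩ i) _))

  -- Free models and setoids of homomorphisms.

  free : SET ℓ → Model 𝕋
  free I = record
    { X       = T I
    ; actFn   = λ J → substFn J I
    ; ⟦proj⟧  = proj-subst
    ; ⟦subst⟧ = subst-subst
    }

  module _ (M : Model 𝕋) where
    open Model M using (X; ⟦_⟧; ⟦proj⟧; ⟦subst⟧)
    open ModelProperties M

    -- Existence half of the universal property of `free I`; `free-ext` is the uniqueness half.
    extend : ∀ {I} → Func I X → Homomorphism 𝕋 (free I) M
    extend {I} x = record
      { fun       = record { to = λ t → ⟦ t ⟧ x ; cong = ⟦⟧-congˡ }
      ; preserves = λ t u → ⟦subst⟧ t u x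
      }

    free-ext : ∀ {I} (f g : Homomorphism 𝕋 (free I) M) →
               (∀ i → Setoid._≈_ X (fun f ⟨$⟩ π i) (fun g ⟨$⟩ π i)) →
               Setoid._≈_ (HomSetoid 𝕋 (free I) M) f g
    free-ext {I} f g p t = begin⟨ X ⟩
      fun f ⟨$⟩ t                                    ≈⟨ Func.cong (fun f) (subst-proj t) ⟨
      fun f ⟨$⟩ t ⟪ proj I ⟫                         ≈⟨ preserves f t _ ⟩
      ⟦ t ⟧ (Composition.function (proj I) (fun f))  ≈⟨ ⟦⟧-congʳ p ⟩
      ⟦ t ⟧ (Composition.function (proj I) (fun g))  ≈⟨ preserves g t _ ⟨
      fun g ⟨$⟩ t ⟪ proj I ⟫                         ≈⟨ Func.cong (fun g) (subst-proj t) ⟩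
      fun g ⟨$⟩ t                                    ∎

  module _ (M N : Model 𝕋) where
    private
      module M = Model M
      module N = Model N

    -- Preserving the operations of arity M at the identity family suffices to
    -- preserve all operations, so that homomorphisms form a small setoid.
    smallHom : SET ℓ
    smallHom = record
      { Carrier       = Σ (Func M.X N.X) λ f →
                          ∀ t → (f ⟨$⟩ M.⟦ t ⟧ (Identity.function M.X)) N.≈ N.⟦ t ⟧ f
      ; _≈_           = λ (f , _) (g , _) → ∀ x → (f ⟨$⟩ x) N.≈ (g ⟨$⟩ x)
      ; isEquivalence = record
        { refl  = λ x → Setoid.refl N.X
        ; sym   = λ p x → Setoid.sym N.X (p x)
        ; trans = λ p q x → Setoid.trans N.X (p x) (q x)
        }
      }

    smallHom→hom : Carrier smallHom → Homomorphism 𝕋 M N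
    smallHom→hom (f , p) = record
      { fun       = f
      ; preserves = λ t x → begin⟨ N.X ⟩
          f ⟨$⟩ M.⟦ t ⟧ x
            ≈⟨ Func.cong f (ModelProperties.⟦reindex⟧ M t x) ⟨
          f ⟨$⟩ M.⟦ t ⟪ Composition.function x (proj M.X) ⟫ ⟧ (Identity.function M.X)
            ≈⟨ p _ ⟩
          N.⟦ t ⟪ Composition.function x (proj M.X) ⟫ ⟧ f
            ≈⟨ N.⟦subst⟧ t _ f ⟩
          N.⟦ t ⟧ (N.⟦ Composition.function x (proj M.X) ⟧ᶠ f)
            ≈⟨ ModelProperties.⟦⟧-congʳ N (λ i → N.⟦proj⟧ (x ⟨$⟩ i) f) ⟩
          N.⟦ t ⟧ (Composition.function x f) ∎
      }

    hom→smallHom : Homomorphism 𝕋 M N → Carrier smallHom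
    hom→smallHom f = fun f , λ t → Setoid.trans N.X (preserves f t _)
      (ModelProperties.⟦⟧-congʳ N (λ _ → Setoid.refl N.X))

  -- Finite products of models.

  terminalModel : Terminal (Mod 𝕋)
  terminalModel = record
    { one      = record
      { X       = 𝟙
      ; actFn   = λ I → const tt
      ; ⟦proj⟧  = λ _ _ → Setoid.refl 𝟙
      ; ⟦subst⟧ = λ _ _ _ → Setoid.refl 𝟙
      }
    ; !        = λ A → record { fun = const tt ; preserves = λ _ _ → Setoid.refl 𝟙 }
    ; !-unique = λ f x → Setoid.refl 𝟙
    }

  module _ (A B : Model 𝕋) where
    private
      module A = Model A
      module B = Model B

    productModel : Product (Mod 𝕋) A B
    productModel = record
      { A×B    = record
        { X       = A.X ×ₛ B.X
        ; actFn   = λ I → record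
          { to   = λ (t , x) → A.⟦ t ⟧ (Composition.function x fst) , B.⟦ t ⟧ (Composition.function x snd)
          ; cong = λ (p , q) → A.⟦⟧-cong p (λ i → proj₁ (q i)) , B.⟦⟧-cong p (λ i → proj₂ (q i))
          }
        ; ⟦proj⟧  = λ i x → A.⟦proj⟧ i _ , B.⟦proj⟧ i _
        ; ⟦subst⟧ = λ t u x → A.⟦subst⟧ t u _ , B.⟦subst⟧ t u _
        }
      ; π₁     = record { fun = fst ; preserves = λ t x → Setoid.refl A.X }
      ; π₂     = record { fun = snd ; preserves = λ t x → Setoid.refl B.X }
      ; ⟨_,_⟩  = λ f g → record
        { fun       = record
          { to   = λ c → fun f ⟨$⟩ c , fun g ⟨$⟩ c
          ; cong = λ p → Func.cong (fun f) p , Func.cong (fun g) p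
          }
        ; preserves = λ t x → preserves f t x , preserves g t x
        }
      ; π₁-β   = λ f g c → Setoid.refl A.X
      ; π₂-β   = λ f g c → Setoid.refl B.X
      ; unique = λ f g k p q c → p c , q c
      }
      where
      fst : Func (A.X ×ₛ B.X) A.X
      fst = record { to = proj₁ ; cong = proj₁ }
      snd : Func (A.X ×ₛ B.X) B.X
      snd = record { to = proj₂ ; cong = proj₂ }

  infixr 7 _⊠_
  _⊠_ : Model 𝕋 → Model 𝕋 → Model 𝕋
  A ⊠ B = Product.A×B (productModel A B)

  -- Decompositions at the generic variables.

  generic : ∀ {I} {t h : Op I} {m} → Decomposes 𝕋 t h m → t ≈ h ⟪ unary 𝕋 m (proj I) ⟫
  generic {I} {t} dec = Setoid.trans (T I) (Setoid.sym (T I) (subst-proj t)) (dec I (proj I))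

  decomposes : ∀ {I} {t h : Op I} {m} → t ≈ h ⟪ unary 𝕋 m (proj I) ⟫ → Decomposes 𝕋 t h m
  decomposes dec K x = ModelProperties.⟦decomposition⟧ (free K) dec x

  π-generic : ∀ m → m ⟪ const (π {𝟙} tt) ⟫ ≈ m
  π-generic m = Setoid.trans (T 𝟙)
    (⟪⟫-cong (Setoid.refl (T 𝟙)) (λ _ → Setoid.refl (T 𝟙))) (subst-proj m)

  -- Identifying all variables collapses the affine `h`, so `t` alone determines `m`.
  unary-part : ∀ {I} {t h : Op I} {m} → IsAffine 𝕋 h → Decomposes 𝕋 t h m →
               t ⟪ const (π {𝟙} tt) ⟫ ≈ m
  unary-part {I} {t} {h} {m} aff dec = begin⟨ T 𝟙 ⟩
    t ⟪ const (π {𝟙} tt) ⟫          ≈⟨ dec 𝟙 (const (π tt)) ⟩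
    h ⟪ unary 𝕋 m (const (π tt)) ⟫  ≈⟨ ⟪⟫-cong (Setoid.refl (T I)) (λ _ → π-generic m) ⟩
    h ⟪ const m ⟫                   ≈⟨ ModelProperties.⟦affine⟧ (free 𝟙) aff m ⟩
    m                                ∎

  private
    _×id[_] : ∀ {A A′} → Homomorphism 𝕋 A A′ → ∀ B → Homomorphism 𝕋 (A ⊠ B) (A′ ⊠ B)
    f ×id[ B ] = _⊗id (Mod 𝕋) productModel {B = B} f

    pair : ∀ A B {C} → Homomorphism 𝕋 C A → Homomorphism 𝕋 C B → Homomorphism 𝕋 C (A ⊠ B)
    pair A B = Product.⟨_,_⟩ (productModel A B)

    infixr 9 _∘_
    _∘_ : ∀ {A B C} → Homomorphism 𝕋 B C → Homomorphism 𝕋 A B → Homomorphism 𝕋 A C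
    _∘_ = compHom 𝕋

  -- The coprojections of `free I` as the I-fold copower of `free 𝟙`.
  copower-incl : ∀ {I} → Carrier I → Homomorphism 𝕋 (free 𝟙) (free I)
  copower-incl {I} i = extend (free I) (const (π i))

  copower-incl-cong : ∀ {I} {i j : Carrier I} → Setoid._≈_ I i j → (m : Op 𝟙) →
                      m ⟪ const (π i) ⟫ ≈ m ⟪ const (π j) ⟫
  copower-incl-cong {I} p m = ⟪⟫-cong (Setoid.refl (T 𝟙)) (λ _ → Func.cong (proj I) p)

  generic-incl : ∀ I (i : Carrier I) → π {𝟙} tt ⟪ const (π {I} i) ⟫ ≈ π {I} i
  generic-incl I i = proj-subst tt (const (π i))

  -- Cartesian closed implies hyperaffine–unary

  module FromExponentials (exponential : ∀ A B → Exponential (Mod 𝕋) productModel A B) where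
    module _ (A B : Model 𝕋) where
      private
        module E = Exponential (exponential A B)
        module B = Setoid (Model.X B)
        module B^A = Setoid (Model.X E.B^A)

      -- A homomorphism into `B^A` is the transpose of its own evaluation.
      eval-ext : ∀ C (k k′ : Homomorphism 𝕋 C E.B^A) →
        (∀ c a → (fun E.eval ⟨$⟩ (fun k ⟨$⟩ c , a)) B.≈ (fun E.eval ⟨$⟩ (fun k′ ⟨$⟩ c , a))) →
        ∀ c → (fun k ⟨$⟩ c) B^A.≈ (fun k′ ⟨$⟩ c)
      eval-ext C k k′ p c = B^A.trans
        (E.unique g k (λ (c , a) → p c a) c)
        (B^A.sym (E.unique g k′ (λ _ → B.refl) c))
        where
        g : Homomorphism 𝕋 (C ⊠ A) B
        g = E.eval ∘ k′ ×id[ A ]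

      -- Exponentiability of A makes free I ⊠ A the I-fold copower of free 𝟙 ⊠ A;
      -- copower-ext is the uniqueness half of its universal property.
      copower-ext : ∀ {I : SET ℓ} (f g : Homomorphism 𝕋 (free I ⊠ A) B) →
        (∀ i m a → (fun f ⟨$⟩ (m ⟪ const (π i) ⟫ , a)) B.≈ (fun g ⟨$⟩ (m ⟪ const (π i) ⟫ , a))) →
        ∀ x → (fun f ⟨$⟩ x) B.≈ (fun g ⟨$⟩ x)
      copower-ext {I} f g p (t , a) = begin⟨ Model.X B ⟩
        fun f ⟨$⟩ (t , a)                              ≈⟨ E.β f (t , a) ⟨
        fun E.eval ⟨$⟩ (fun (E.curry f) ⟨$⟩ t , a)
          ≈⟨ Func.cong (fun E.eval) (free-ext E.B^A (E.curry f) (E.curry g) at-generator t , Setoid.refl (Model.X A)) ⟩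
        fun E.eval ⟨$⟩ (fun (E.curry g) ⟨$⟩ t , a)     ≈⟨ E.β g (t , a) ⟩
        fun g ⟨$⟩ (t , a)                              ∎
        where
        -- `eval-ext` compares homomorphisms rather than single elements, so `π i` is written as the
        -- image of the generic variable under `copower-incl i`.
        at-generator : ∀ i → (fun (E.curry f) ⟨$⟩ π i) B^A.≈ (fun (E.curry g) ⟨$⟩ π i)
        at-generator i = begin⟨ Model.X E.B^A ⟩
          fun (E.curry f) ⟨$⟩ π i          ≈⟨ Func.cong (fun (E.curry f)) (generic-incl I i) ⟨
          fun (E.curry f) ⟨$⟩ π {𝟙} tt ⟪ const (π i) ⟫
            ≈⟨ eval-ext (free 𝟙) (E.curry f ∘ copower-incl {I} i) (E.curry g ∘ copower-incl {I} i)
                 (λ m a → B.trans (E.β f _) (B.trans (p i m a) (B.sym (E.β g _)))) (π {𝟙} tt) ⟩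
          fun (E.curry g) ⟨$⟩ π {𝟙} tt ⟪ const (π i) ⟫
                                           ≈⟨ Func.cong (fun (E.curry g)) (generic-incl I i) ⟩
          fun (E.curry g) ⟨$⟩ π i          ∎

      module _ {I : SET ℓ} (f : Func I (HomSetoid 𝕋 A B)) where
        private
          transposed : Carrier I → Homomorphism 𝕋 (free 𝟙) E.B^A
          transposed i = E.curry ((f ⟨$⟩ i) ∘ Product.π₂ (productModel (free 𝟙) A))

          point : Func I (Model.X E.B^A)
          point = record
            { to   = λ i → fun (transposed i) ⟨$⟩ π tt
            ; cong = λ {i} {j} p → eval-ext (free 𝟙) (transposed i) (transposed j)
                (λ m a → B.trans (E.β _ (m , a)) (B.trans (Func.cong f p a) (B.sym (E.β _ (m , a)))))
                (π tt)
            }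

        -- Existence half of the copower property, for the maps `(m , a) ↦ fᵢ(a)` that ignore the
        -- first component. Both ψ and χ arise from such families.
        copower-elim : Homomorphism 𝕋 (free I ⊠ A) B
        copower-elim = E.eval ∘ extend E.B^A point ×id[ A ]

        copower-elim-β : ∀ i m a →
          (fun copower-elim ⟨$⟩ (m ⟪ const (π i) ⟫ , a)) B.≈ (fun (f ⟨$⟩ i) ⟨$⟩ a)
        copower-elim-β i m a = begin⟨ Model.X B ⟩
          fun E.eval ⟨$⟩ (fun (extend E.B^A point) ⟨$⟩ m ⟪ const (π i) ⟫ , a)
            -- On `free 𝟙` both homomorphisms send the generic variable to `point` at `i`, hence
            -- they agree at every `m`.
            ≈⟨ Func.cong (fun E.eval)
                 ( free-ext E.B^A (extend E.B^A point ∘ copower-incl {I} i) (transposed i)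
                     (λ _ → B^A.trans (Func.cong (fun (extend E.B^A point)) (generic-incl I i))
                                      (Model.⟦proj⟧ E.B^A i point))
                     m
                 , Setoid.refl (Model.X A)) ⟩
          fun E.eval ⟨$⟩ (fun (transposed i) ⟨$⟩ m , a)   ≈⟨ E.β _ (m , a) ⟩
          fun (f ⟨$⟩ i) ⟨$⟩ a                             ∎

        copower-elim-π : ∀ i a → (fun copower-elim ⟨$⟩ (π i , a)) B.≈ (fun (f ⟨$⟩ i) ⟨$⟩ a)
        copower-elim-π i a = B.trans
          (Func.cong (fun copower-elim) (Setoid.sym (T I) (generic-incl I i) , Setoid.refl (Model.X A)))
          (copower-elim-β i (π tt) a)

    affine⇒hyperaffine : ∀ {I} {t : Op I} → IsAffine 𝕋 t → IsHyperaffine 𝕋 t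
    affine⇒hyperaffine {I} {t} aff = aff , (begin⟨ T (I ×ₛ I) ⟩
      t ⟪ rows 𝕋 t ⟫
        ≈⟨ ⟪⟫-cong (Setoid.refl (T I)) (λ i → copower-elim-π (free I) (free (I ×ₛ I)) f i t) ⟨
      t ⟪ Composition.function family (fun χ) ⟫
        ≈⟨ preserves χ t family ⟨
      fun χ ⟨$⟩ (t ⟪ proj I ⟫ , t ⟪ const t ⟫)
        -- Affineness collapses the constant second component, which brings χ to the diagonal.
        ≈⟨ Func.cong (fun χ) (subst-proj t , ModelProperties.⟦affine⟧ (free I) aff t) ⟩
      fun χ ⟨$⟩ (t , t)
        -- Restricted to the diagonal, χ is a homomorphism out of a free model, so only its values
        -- at the variables matter.
        ≈⟨ free-ext (free (I ×ₛ I)) (χ ∘ pair (free I) (free I) (idHom 𝕋) (idHom 𝕋)) (extend (free (I ×ₛ I)) (diagonal 𝕋))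
             (λ i → Setoid.trans (T (I ×ₛ I)) (copower-elim-π (free I) (free (I ×ₛ I)) f i (π i))
                      (Setoid.trans (T (I ×ₛ I)) (proj-subst i _)
                        (Setoid.sym (T (I ×ₛ I)) (proj-subst i _)))) t ⟩
      t ⟪ diagonal 𝕋 ⟫ ∎)
      where
      f : Func I (HomSetoid 𝕋 (free I) (free (I ×ₛ I)))
      f = record
        { to   = λ i → extend (free (I ×ₛ I)) (row 𝕋 i)
        ; cong = λ p s → ⟪⟫-cong (Setoid.refl (T I))
                           (λ j → Func.cong (proj (I ×ₛ I)) (p , Setoid.refl I))
        }
      χ : Homomorphism 𝕋 (free I ⊠ free I) (free (I ×ₛ I))
      χ = copower-elim (free I) (free (I ×ₛ I)) f
      family : Func I (T I ×ₛ T I)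
      family = record
        { to   = λ i → π i , t
        ; cong = λ p → Func.cong (proj I) p , Setoid.refl (T I)
        }

    module _ {I : SET ℓ} where
      private
        inclusions : Func I (HomSetoid 𝕋 (free 𝟙) (free I))
        inclusions = record { to = copower-incl ; cong = copower-incl-cong }

      -- On m(xᵢ) and n this returns n(xᵢ): it replaces the unary part of an
      -- operation while keeping its hyperaffine part.
      setUnary : Homomorphism 𝕋 (free I ⊠ free 𝟙) (free I)
      setUnary = copower-elim (free 𝟙) (free I) inclusions

      private
        ψ : Op I → Op 𝟙 → Op I
        ψ t n = fun setUnary ⟨$⟩ (t , n)

        ψ-β : ∀ i m n → ψ (m ⟪ const (π i) ⟫) n ≈ n ⟪ const (π i) ⟫
        ψ-β = copower-elim-β (free 𝟙) (free I) inclusions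

        ψ-cong : ∀ {t t′ n n′} → t ≈ t′ → n ≈ n′ → ψ t n ≈ ψ t′ n′
        ψ-cong p q = Func.cong (fun setUnary) (p , q)

        x : Op 𝟙
        x = π tt

      -- Both sides are homomorphic in the pair `(t , n)`, so `t = m(xᵢ)` is the only case to check.
      -- At `n = x` this is affineness of the future hyperaffine part `ψ t x`.
      setUnary-unary : ∀ t n → ψ t n ⟪ const x ⟫ ≈ n
      setUnary-unary t n = copower-ext (free 𝟙) (free 𝟙)
        (extend (free 𝟙) (const x) ∘ setUnary) (Product.π₂ (productModel (free I) (free 𝟙)))
        (λ i m n → begin⟨ T 𝟙 ⟩
          ψ (m ⟪ const (π i) ⟫) n ⟪ const x ⟫
            ≈⟨ ⟪⟫-cong (ψ-β i m n) (λ _ → Setoid.refl (T 𝟙)) ⟩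
          n ⟪ const (π i) ⟫ ⟪ const x ⟫    ≈⟨ subst-subst n _ _ ⟩
          n ⟪ const (π i) ⟪ const x ⟫ᶠ ⟫
            ≈⟨ ⟪⟫-cong (Setoid.refl (T 𝟙)) (λ _ → proj-subst i _) ⟩
          n ⟪ proj 𝟙 ⟫                     ≈⟨ subst-proj n ⟩
          n                                ∎)
        (t , n)

      -- Both sides are homomorphic in `t`, so it suffices to check projections.
      setUnary-self : ∀ t → ψ t (t ⟪ const x ⟫) ≈ t
      setUnary-self = free-ext (free I)
        (setUnary ∘ pair (free I) (free 𝟙) (idHom 𝕋) (extend (free 𝟙) (const x))) (idHom 𝕋)
        (λ i → begin⟨ T I ⟩
          ψ (π i) (π i ⟪ const x ⟫)    ≈⟨ ψ-cong (Setoid.refl (T I)) (proj-subst i _) ⟩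
          ψ (π i) x                    ≈⟨ copower-elim-π (free 𝟙) (free I) inclusions i x ⟩
          x ⟪ const (π i) ⟫            ≈⟨ generic-incl I i ⟩
          π i                          ∎)

      -- Taken at `n = x` and `m = t(λ i. x)`, this turns `setUnary-self` into the decomposition of
      -- `t`.
      setUnary-subst : ∀ m t n → ψ t (n ⟪ const m ⟫) ≈ ψ t n ⟪ unary 𝕋 m (proj I) ⟫
      setUnary-subst m t n = copower-ext (free 𝟙) (free I)
        (setUnary ∘ pair (free I) (free 𝟙) (Product.π₁ P) (extend (free 𝟙) (const m) ∘ Product.π₂ P))
        (extend (free I) (unary 𝕋 m (proj I)) ∘ setUnary)
        (λ i m′ n → begin⟨ T I ⟩
          ψ (m′ ⟪ const (π i) ⟫) (n ⟪ const m ⟫)     ≈⟨ ψ-β i m′ _ ⟩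
          n ⟪ const m ⟫ ⟪ const (π i) ⟫              ≈⟨ subst-subst n _ _ ⟩
          n ⟪ const m ⟪ const (π i) ⟫ᶠ ⟫
            ≈⟨ ⟪⟫-cong (Setoid.refl (T 𝟙)) (λ _ → proj-subst i _) ⟨
          n ⟪ const (π i) ⟪ unary 𝕋 m (proj I) ⟫ᶠ ⟫  ≈⟨ subst-subst n _ _ ⟨
          n ⟪ const (π i) ⟫ ⟪ unary 𝕋 m (proj I) ⟫
            ≈⟨ ⟪⟫-cong (ψ-β i m′ n) (λ _ → Setoid.refl (T I)) ⟨
          ψ (m′ ⟪ const (π i) ⟫) n ⟪ unary 𝕋 m (proj I) ⟫ ∎)
        (t , n)
        where P = productModel (free I) (free 𝟙)

      -- Yields uniqueness of the hyperaffine part, since `ψ t x` does not mention `h`.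
      setUnary-hyperaffine : ∀ {t h m} → IsAffine 𝕋 h → Decomposes 𝕋 t h m → ψ t x ≈ h
      setUnary-hyperaffine {t} {h} {m} aff dec = begin⟨ T I ⟩
        ψ t x
          -- Affineness rewrites `x` as `h(λ i. x)`, so that `h` can be pulled out of both arguments
          -- of ψ at once.
          ≈⟨ ψ-cong (generic dec) (Setoid.sym (T 𝟙) aff) ⟩
        ψ (h ⟪ unary 𝕋 m (proj I) ⟫) (h ⟪ const x ⟫)
          ≈⟨ preserves setUnary h family ⟩
        h ⟪ Composition.function family (fun setUnary) ⟫
          ≈⟨ ⟪⟫-cong (Setoid.refl (T I))
               (λ i → Setoid.trans (T I) (ψ-β i m x) (generic-incl I i)) ⟩
        h ⟪ proj I ⟫
          ≈⟨ subst-proj h ⟩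
        h ∎
        where
        family : Func I (T I ×ₛ T 𝟙)
        family = record
          { to   = λ i → m ⟪ const (π i) ⟫ , x
          ; cong = λ p → copower-incl-cong p m , Setoid.refl (T 𝟙)
          }

      hyperaffine-unary : ∀ (t : Op I) → Decomposes 𝕋 t (ψ t x) (t ⟪ const x ⟫)
      hyperaffine-unary t = decomposes (begin⟨ T I ⟩
        t                                           ≈⟨ setUnary-self t ⟨
        ψ t (t ⟪ const x ⟫)
          ≈⟨ ψ-cong (Setoid.refl (T I)) (proj-subst tt _) ⟨
        ψ t (x ⟪ const (t ⟪ const x ⟫) ⟫)           ≈⟨ setUnary-subst _ t x ⟩
        ψ t x ⟪ unary 𝕋 (t ⟪ const x ⟫) (proj I) ⟫  ∎)

    isHyperaffineUnary : IsHyperaffineUnary 𝕋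
    isHyperaffineUnary I t =
      (fun setUnary ⟨$⟩ (t , π tt) , t ⟪ const (π tt) ⟫) ,
      (affine⇒hyperaffine (setUnary-unary t (π tt)) , hyperaffine-unary t) ,
      λ ((aff , _) , dec) → setUnary-hyperaffine aff dec , unary-part aff dec

  -- Hyperaffine–unary implies cartesian closed

  module FromDecompositions (decompose : IsHyperaffineUnary 𝕋) where
    private
      x : Op 𝟙
      x = π tt

    hyperaffinePart : ∀ {I} → Op I → Op I
    hyperaffinePart {I} t = proj₁ (proj₁ (decompose I t))

    unaryPart : ∀ {I} → Op I → Op 𝟙
    unaryPart {I} t = proj₂ (proj₁ (decompose I t))

    hyperaffinePart-hyperaffine : ∀ {I} (t : Op I) → IsHyperaffine 𝕋 (hyperaffinePart t)
    hyperaffinePart-hyperaffine {I} t = proj₁ (proj₁ (proj₂ (decompose I t)))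

    hyperaffinePart-affine : ∀ {I} (t : Op I) → IsAffine 𝕋 (hyperaffinePart t)
    hyperaffinePart-affine t = proj₁ (hyperaffinePart-hyperaffine t)

    decomposition : ∀ {I} (t : Op I) → Decomposes 𝕋 t (hyperaffinePart t) (unaryPart t)
    decomposition {I} t = proj₂ (proj₁ (proj₂ (decompose I t)))

    parts-unique : ∀ {I} {t h : Op I} {m} → IsHyperaffine 𝕋 h →
                   t ≈ h ⟪ unary 𝕋 m (proj I) ⟫ →
                   (hyperaffinePart t ≈ h) × (unaryPart t ≈ m)
    parts-unique {I} {t} hyp dec = proj₂ (proj₂ (decompose I t)) (hyp , decomposes dec)

    -- `decompose` is a bare function on representatives; uniqueness of the pair makes it respect
    -- the equality of operations.
    parts-cong : ∀ {I} {t t′ : Op I} → t ≈ t′ →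
                 (hyperaffinePart t ≈ hyperaffinePart t′) × (unaryPart t ≈ unaryPart t′)
    parts-cong {I} {t} {t′} p = parts-unique (hyperaffinePart-hyperaffine t′)
      (Setoid.trans (T I) p (generic (decomposition t′)))

    unaryPart-const : ∀ {I} (t : Op I) → unaryPart t ≈ t ⟪ const x ⟫
    unaryPart-const t =
      Setoid.sym (T 𝟙) (unary-part (hyperaffinePart-affine t) (decomposition t))

    hyperaffine-resp : ∀ {I} {t t′ : Op I} → t ≈ t′ → IsHyperaffine 𝕋 t → IsHyperaffine 𝕋 t′
    hyperaffine-resp {I} {t} {t′} p (aff , hyp) =
      Setoid.trans (T 𝟙) (⟪⟫-cong (Setoid.sym (T I) p) (λ _ → Setoid.refl (T 𝟙))) aff ,
      (begin⟨ T (I ×ₛ I) ⟩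
        t′ ⟪ rows 𝕋 t′ ⟫
          ≈⟨ ⟪⟫-cong p (λ i → ⟪⟫-cong p (λ j → Setoid.refl (T (I ×ₛ I)))) ⟨
        t ⟪ rows 𝕋 t ⟫       ≈⟨ hyp ⟩
        t ⟪ diagonal 𝕋 ⟫     ≈⟨ ⟪⟫-cong p (λ _ → Setoid.refl (T (I ×ₛ I))) ⟩
        t′ ⟪ diagonal 𝕋 ⟫    ∎)

    -- The unary part of an affine operation is the variable, so the operation equals its own
    -- hyperaffine part.
    affine⇒hyperaffine : ∀ {I} {t : Op I} → IsAffine 𝕋 t → IsHyperaffine 𝕋 t
    affine⇒hyperaffine {I} {t} aff = hyperaffine-resp (begin⟨ T I ⟩
      hyperaffinePart t                                  ≈⟨ subst-proj _ ⟨
      hyperaffinePart t ⟪ proj I ⟫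
        ≈⟨ ⟪⟫-cong (Setoid.refl (T I)) (λ i → Setoid.trans (T I)
             (⟪⟫-cong (Setoid.trans (T 𝟙) (unaryPart-const t) aff) (λ _ → Setoid.refl (T I)))
             (generic-incl I i)) ⟨
      hyperaffinePart t ⟪ unary 𝕋 (unaryPart t) (proj I) ⟫ ≈⟨ generic (decomposition t) ⟨
      t                                                  ∎)
      (hyperaffinePart-hyperaffine t)

    hyperaffinePartᶠ : ∀ {I J : SET ℓ} → Func J (T I) → Func J (T I)
    hyperaffinePartᶠ t = record
      { to   = λ j → hyperaffinePart (t ⟨$⟩ j)
      ; cong = λ p → proj₁ (parts-cong (Func.cong t p))
      }

    unaryPartᶠ : ∀ {I J : SET ℓ} → Func J (T I) → Func J (T 𝟙)
    unaryPartᶠ t = record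
      { to   = λ j → unaryPart (t ⟨$⟩ j)
      ; cong = λ p → proj₂ (parts-cong (Func.cong t p))
      }

    -- The hyperaffine h′ with m(h(xᵢ)) = h′(λ i. m(xᵢ)).
    move : ∀ {I} → Op 𝟙 → Op I → Op I
    move m h = hyperaffinePart (m ⟪ const h ⟫)

    -- Decomposition of composite operations.

    ⟪affine⟫-affine : ∀ {I J} {t : Op J} {u : Func J (T I)} →
      IsAffine 𝕋 t → (∀ j → IsAffine 𝕋 (u ⟨$⟩ j)) → IsAffine 𝕋 (t ⟪ u ⟫)
    ⟪affine⟫-affine {I} {J} {t} {u} t-aff u-aff = begin⟨ T 𝟙 ⟩
      t ⟪ u ⟫ ⟪ const x ⟫      ≈⟨ subst-subst t u _ ⟩
      t ⟪ u ⟪ const x ⟫ᶠ ⟫     ≈⟨ ⟪⟫-cong (Setoid.refl (T J)) u-aff ⟩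
      t ⟪ const x ⟫            ≈⟨ t-aff ⟩
      x                        ∎

    module _ (M : Model 𝕋) where
      open Model M using (X; ⟦_⟧; ⟦_⟧ᶠ; ⟦proj⟧; ⟦subst⟧)
      open ModelProperties M
      private
        module X = Setoid X
        _≋_ : Carrier X → Carrier X → Set ℓ
        _≋_ = Model._≈_ M

      -- Since `h` is affine, the unary part of `m(h(xᵢ))` is again `m`, and decomposing carries `m`
      -- inside.
      ⟦move⟧ : ∀ {I} (m : Op 𝟙) {h : Op I} → IsAffine 𝕋 h → (y : Func I X) →
               ⟦ m ⟧ (const (⟦ h ⟧ y)) ≋ ⟦ move m h ⟧ (⟦ m ⟧₁ y)
      ⟦move⟧ {I} m {h} aff y = begin⟨ X ⟩
        ⟦ m ⟧ (const (⟦ h ⟧ y))       ≈⟨ ⟦⟧-congʳ (λ _ → X.refl) ⟩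
        ⟦ m ⟧ (⟦ const h ⟧ᶠ y)        ≈⟨ ⟦subst⟧ m (const h) y ⟨
        ⟦ m ⟪ const h ⟫ ⟧ y           ≈⟨ ⟦decomposition⟧ (generic (decomposition _)) y ⟩
        ⟦ move m h ⟧ (⟦ unaryPart (m ⟪ const h ⟫) ⟧₁ y)
          ≈⟨ ⟦⟧-congʳ (λ i → ⟦⟧-congˡ unary≈m) ⟩
        ⟦ move m h ⟧ (⟦ m ⟧₁ y)       ∎
        where
        unary≈m : unaryPart (m ⟪ const h ⟫) ≈ m
        unary≈m = begin⟨ T 𝟙 ⟩
          unaryPart (m ⟪ const h ⟫)     ≈⟨ unaryPart-const _ ⟩
          m ⟪ const h ⟫ ⟪ const x ⟫     ≈⟨ subst-subst m _ _ ⟩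
          m ⟪ const h ⟪ const x ⟫ᶠ ⟫    ≈⟨ ⟪⟫-cong (Setoid.refl (T 𝟙)) (λ _ → aff) ⟩
          m ⟪ const x ⟫                 ≈⟨ π-generic m ⟩
          m                             ∎

      module _ {I J : SET ℓ} {k : Op J} {h : Func J (T I)}
               (k-aff : IsAffine 𝕋 k) (h-aff : ∀ j → IsAffine 𝕋 (h ⟨$⟩ j)) where
        private
          -- The operation k(λ j. hⱼ(λ i. x_{ji})).
          u : Op (J ×ₛ I)
          u = k ⟪ ModelProperties.⟦_⟧₂ (free (J ×ₛ I)) h (proj (J ×ₛ I)) ⟫

          ⟦u⟧ : (y : Func (J ×ₛ I) X) → ⟦ u ⟧ y ≋ ⟦ k ⟧ (⟦ h ⟧₂ y)
          ⟦u⟧ y = X.trans (⟦subst⟧ k _ y) (⟦⟧-congʳ (λ j →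
            X.trans (⟦subst⟧ (h ⟨$⟩ j) _ y) (⟦⟧-congʳ (λ i → ⟦proj⟧ (j , i) y))))

          u-hyperaffine : IsHyperaffine 𝕋 u
          u-hyperaffine = affine⇒hyperaffine (⟪affine⟫-affine k-aff (λ j →
            ⟪affine⟫-affine (h-aff j) (λ i → proj-subst (j , i) _)))

        -- Hyperaffineness of u at the variables y_{j′i}, where (j , i) and
        -- (j′ , i′) are the outer and inner indices.
        absorb : (y : Func (J ×ₛ I) X) →
                 ⟦ k ⟪ h ⟫ ⟧ (⟦ const k ⟧₂ (transpose y)) ≋ ⟦ k ⟧ (⟦ h ⟧₂ y)
        absorb y = begin⟨ X ⟩
          ⟦ k ⟪ h ⟫ ⟧ (⟦ const k ⟧₂ (transpose y))     ≈⟨ ⟦subst⟧ k h _ ⟩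
          ⟦ k ⟧ (⟦ h ⟧ᶠ (⟦ const k ⟧₂ (transpose y)))
            -- The variables of the inner `u` do not depend on i′, so each affine `h` at j′
            -- collapses and only `k` remains.
            ≈⟨ ⟦⟧-congʳ (λ j → ⟦⟧-congʳ (λ i → X.trans (⟦u⟧ (slice z (j , i)))
                 (⟦⟧-congʳ (λ j′ → X.trans (⟦⟧-congʳ (λ i′ → X.refl))
                                            (⟦affine⟧ (h-aff j′) (y ⟨$⟩ (j′ , i))))))) ⟨
          ⟦ k ⟧ (⟦ h ⟧₂ (⟦ const u ⟧₂ z))              ≈⟨ ⟦u⟧ _ ⟨
          ⟦ u ⟧ (⟦ const u ⟧₂ z)                       ≈⟨ ⟦hyperaffine⟧ u-hyperaffine z ⟩
          ⟦ u ⟧ (⟦ diagonal 𝕋 ⟧ᶠ z)                    ≈⟨ ⟦⟧-congʳ (λ p → ⟦proj⟧ (p , p) z) ⟩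
          ⟦ u ⟧ y                                      ≈⟨ ⟦u⟧ y ⟩
          ⟦ k ⟧ (⟦ h ⟧₂ y)                             ∎
          where
          z : Func ((J ×ₛ I) ×ₛ (J ×ₛ I)) X
          z = record
            { to   = λ ((_ , i) , (j′ , _)) → y ⟨$⟩ (j′ , i)
            ; cong = λ ((_ , p) , (q , _)) → Func.cong y (q , p)
            }

    module _ {I J : SET ℓ} (r : Op J) (t : Func J (T I)) where
      private
        moved : Func J (T I)
        moved = record
          { to   = λ j → move (unaryPart r) (hyperaffinePart (t ⟨$⟩ j))
          ; cong = λ p → proj₁ (parts-cong (⟪⟫-cong (Setoid.refl (T 𝟙))
                     (λ _ → Func.cong (hyperaffinePartᶠ t) p)))
          }

        -- The hyperaffine part of `r ⟪ t ⟫`, as `parts-⟪⟫` shows.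
        joint : Op I
        joint = hyperaffinePart r ⟪ moved ⟫

      module _ (M : Model 𝕋) where
        open Model M using (X; ⟦_⟧; ⟦_⟧ᶠ)
        open ModelProperties M
        private
          module X = Setoid X
          _≋_ : Carrier X → Carrier X → Set ℓ
          _≋_ = Model._≈_ M

        -- Interchange of `r` with the hyperaffine parts of the tⱼ: `⟦move⟧` carries the unary part
        -- of `r` inwards, and `absorb` deals with its hyperaffine part. Both `parts-⟪⟫` and the
        -- homomorphism property of `copower-elim` rest on it.
        ⟦joint⟧ : (y : Func (J ×ₛ I) X) →
                  ⟦ joint ⟧ (⟦ const r ⟧₂ (transpose y)) ≋ ⟦ r ⟧ (⟦ hyperaffinePartᶠ t ⟧₂ y)
        ⟦joint⟧ y = begin⟨ X ⟩
          ⟦ joint ⟧ (⟦ const r ⟧₂ (transpose y))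
            ≈⟨ ⟦⟧-congʳ (λ i → X.trans (⟦decomposition⟧ (generic (decomposition r)) _)
                                       (⟦⟧-congʳ (λ j → X.refl))) ⟩
          ⟦ joint ⟧ (⟦ const (hyperaffinePart r) ⟧₂ (transpose (⟦ unaryPart r ⟧₁ y)))
            ≈⟨ absorb M (hyperaffinePart-affine r) (λ j → hyperaffinePart-affine _) (⟦ unaryPart r ⟧₁ y) ⟩
          ⟦ hyperaffinePart r ⟧ (⟦ moved ⟧₂ (⟦ unaryPart r ⟧₁ y))
            ≈⟨ ⟦⟧-congʳ (λ j → X.trans
                 (⟦move⟧ M (unaryPart r) (hyperaffinePart-affine (t ⟨$⟩ j)) (slice y j))
                 (⟦⟧-congʳ (λ i → X.refl))) ⟨
          ⟦ hyperaffinePart r ⟧ (⟦ unaryPart r ⟧₁ (⟦ hyperaffinePartᶠ t ⟧₂ y))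
            ≈⟨ ⟦decomposition⟧ (generic (decomposition r)) _ ⟨
          ⟦ r ⟧ (⟦ hyperaffinePartᶠ t ⟧₂ y) ∎

      -- By uniqueness it is enough that the two form a decomposition. This is `⟦joint⟧` in `free I`
      -- at `y` with entries mⱼ(xᵢ), where mⱼ is the unary part of tⱼ.
      parts-⟪⟫ : (hyperaffinePart (r ⟪ t ⟫) ≈ joint) × (unaryPart (r ⟪ t ⟫) ≈ r ⟪ unaryPartᶠ t ⟫)
      parts-⟪⟫ = parts-unique
        (affine⇒hyperaffine (⟪affine⟫-affine (hyperaffinePart-affine r) (λ j → hyperaffinePart-affine _)))
        (begin⟨ T I ⟩
          r ⟪ t ⟫
            ≈⟨ ⟪⟫-cong (Setoid.refl (T J)) (λ j → Setoid.trans (T I)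
                 (generic (decomposition (t ⟨$⟩ j)))
                 (⟪⟫-cong (Setoid.refl (T I)) (λ i → Setoid.refl (T I)))) ⟩
          r ⟪ ModelProperties.⟦_⟧₂ (free I) (hyperaffinePartᶠ t) y ⟫
            ≈⟨ ⟦joint⟧ (free I) y ⟨
          joint ⟪ ModelProperties.⟦_⟧₂ (free I) (const r) (transpose y) ⟫
            ≈⟨ ⟪⟫-cong (Setoid.refl (T I)) (λ i → Setoid.trans (T I)
                 (subst-subst r _ _) (⟪⟫-cong (Setoid.refl (T J)) (λ j → Setoid.refl (T I)))) ⟨
          joint ⟪ unary 𝕋 (r ⟪ unaryPartᶠ t ⟫) (proj I) ⟫ ∎)
        where
        y : Func (J ×ₛ I) (T I)
        y = record
          { to   = λ (j , i) → unaryPart (t ⟨$⟩ j) ⟪ const (π i) ⟫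
          ; cong = λ (p , q) → ⟪⟫-cong (Func.cong (unaryPartᶠ t) p) (λ _ → Func.cong (proj I) q)
          }

    -- Exponentials of models.

    module _ (A B : Model 𝕋) where
      private
        module A = Model A
        module B = Model B
        module BP = ModelProperties B
        BX = Model.X B
        module BX = Setoid (Model.X B)

      module _ {I : SET ℓ} (f : Func I (HomSetoid 𝕋 (free 𝟙 ⊠ A) B)) where
        private
          values : Op 𝟙 → Carrier A.X → Func I B.X
          values m a = record
            { to   = λ i → fun (f ⟨$⟩ i) ⟨$⟩ (m , a)
            ; cong = λ p → Func.cong f p (m , a)
            }

        -- free I ⊠ A is the I-fold copower of free 𝟙 ⊠ A, since
        -- (t , a) = h(λ i. (m(xᵢ) , a)) for the decomposition t = h(λ i. m(xᵢ)).
        copower-elim : Homomorphism 𝕋 (free I ⊠ A) B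
        copower-elim = record
          { fun       = record
            { to   = λ (t , a) → B.⟦ hyperaffinePart t ⟧ (values (unaryPart t) a)
            ; cong = λ (p , q) → B.⟦⟧-cong (proj₁ (parts-cong p))
                       (λ i → Func.cong (fun (f ⟨$⟩ i)) (proj₂ (parts-cong p) , q))
            }
          ; preserves = λ {J} r w → preserving r (Composition.function w fst) (Composition.function w snd)
          }
          where
          fst = fun (Product.π₁ (productModel (free I) A))
          snd = fun (Product.π₂ (productModel (free I) A))

          preserving : ∀ {J} (r : Op J) (t : Func J (T I)) (a : Func J A.X) →
            B.⟦ hyperaffinePart (r ⟪ t ⟫) ⟧ (values (unaryPart (r ⟪ t ⟫)) (A.⟦ r ⟧ a)) B.≈
            B.⟦ r ⟧ (record
              { to   = λ j → B.⟦ hyperaffinePart (t ⟨$⟩ j) ⟧ (values (unaryPart (t ⟨$⟩ j)) (a ⟨$⟩ j))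
              ; cong = λ p → B.⟦⟧-cong (Func.cong (hyperaffinePartᶠ t) p)
                  (λ i → Func.cong (fun (f ⟨$⟩ i)) (Func.cong (unaryPartᶠ t) p , Func.cong a p))
              })
          preserving {J} r t a = begin⟨ BX ⟩
            B.⟦ hyperaffinePart (r ⟪ t ⟫) ⟧ (values (unaryPart (r ⟪ t ⟫)) (A.⟦ r ⟧ a))
              -- Each fᵢ preserves `r`, which reduces the claim to `⟦joint⟧` at `y` with entries
              -- fᵢ(mⱼ, aⱼ).
              ≈⟨ B.⟦⟧-cong (proj₁ (parts-⟪⟫ r t)) (λ i → BX.trans
                   (Func.cong (fun (f ⟨$⟩ i)) (proj₂ (parts-⟪⟫ r t) , Setoid.refl A.X))
                   (BX.trans (preserves (f ⟨$⟩ i) r args) (BP.⟦⟧-congʳ (λ j → BX.refl)))) ⟩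
            B.⟦ _ ⟧ (BP.⟦ const r ⟧₂ (transpose y))
              ≈⟨ ⟦joint⟧ r t B y ⟩
            B.⟦ r ⟧ (BP.⟦ hyperaffinePartᶠ t ⟧₂ y)
              ≈⟨ BP.⟦⟧-congʳ (λ j → BP.⟦⟧-congʳ (λ i → BX.refl)) ⟩
            B.⟦ r ⟧ _ ∎
            where
            args : Func J (T 𝟙 ×ₛ A.X)
            args = record
              { to   = λ j → unaryPart (t ⟨$⟩ j) , a ⟨$⟩ j
              ; cong = λ p → Func.cong (unaryPartᶠ t) p , Func.cong a p
              }
            y : Func (J ×ₛ I) B.X
            y = record
              { to   = λ (j , i) → fun (f ⟨$⟩ i) ⟨$⟩ (args ⟨$⟩ j)
              ; cong = λ {(j , i)} {(j′ , i′)} (p , q) →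
                  BX.trans (Func.cong f q (args ⟨$⟩ j)) (Func.cong (fun (f ⟨$⟩ i′)) (Func.cong args p))
              }

        copower-elim-β : ∀ i m a →
          (fun copower-elim ⟨$⟩ (m ⟪ const (π i) ⟫ , a)) B.≈ (fun (f ⟨$⟩ i) ⟨$⟩ (m , a))
        copower-elim-β i m a = BX.trans
          (B.⟦⟧-cong (proj₁ parts) (λ j → Func.cong (fun (f ⟨$⟩ j)) (proj₂ parts , Setoid.refl A.X)))
          (B.⟦proj⟧ i (values m a))
          where
          -- A projection is affine, so `m(xᵢ)` has hyperaffine part `π i` and unary part `m`.
          parts = parts-unique {t = m ⟪ const (π i) ⟫} {h = π i} {m = m}
            (affine⇒hyperaffine (proj-subst i _))
            (Setoid.sym (T I) (proj-subst i (unary 𝕋 m (proj I))))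

      module _ (C : Model 𝕋) (g : Homomorphism 𝕋 (C ⊠ A) B) where
        private
          module C = Model C
          module CP = ModelProperties C

        -- The affine part of `s` fixes `a`, so it can be pulled out of the pair although `s` acts
        -- on the first component only. Leaving `y` free up to pointwise equality spares callers
        -- from matching congruence proofs.
        decomposeˡ : ∀ {I} (s : Op I) (c : Func I C.X) (a : Carrier A.X) (y : Func I B.X) →
          (∀ i → (y ⟨$⟩ i) B.≈ (fun g ⟨$⟩ (C.⟦ unaryPart s ⟧ (const (c ⟨$⟩ i)) , a))) →
          (fun g ⟨$⟩ (C.⟦ s ⟧ c , a)) B.≈ B.⟦ hyperaffinePart s ⟧ y
        decomposeˡ {I} s c a y y≈ = begin⟨ BX ⟩
          fun g ⟨$⟩ (C.⟦ s ⟧ c , a)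
            ≈⟨ Func.cong (fun g)
                 ( CP.⟦decomposition⟧ (generic (decomposition s)) c
                 , Setoid.sym A.X (ModelProperties.⟦affine⟧ A (hyperaffinePart-affine s) a)) ⟩
          fun g ⟨$⟩ (C.⟦ hyperaffinePart s ⟧ (CP.⟦ unaryPart s ⟧₁ c) , A.⟦ hyperaffinePart s ⟧ (const a))
            ≈⟨ preserves g (hyperaffinePart s) args ⟩
          B.⟦ hyperaffinePart s ⟧ (Composition.function args (fun g))
            ≈⟨ BP.⟦⟧-congʳ y≈ ⟨
          B.⟦ hyperaffinePart s ⟧ y ∎
          where
          args : Func I (C.X ×ₛ A.X)
          args = record
            { to   = λ i → C.⟦ unaryPart s ⟧ (const (c ⟨$⟩ i)) , a
            ; cong = λ p → Func.cong (CP.⟦ unaryPart s ⟧₁ c) p , Setoid.refl A.X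
            }

      private
        small = smallHom (free 𝟙 ⊠ A) B
        toHom = smallHom→hom (free 𝟙 ⊠ A) B
        ofHom = hom→smallHom (free 𝟙 ⊠ A) B

        homs : ∀ {I : SET ℓ} → Func I small → Func I (HomSetoid 𝕋 (free 𝟙 ⊠ A) B)
        homs φ = record { to = λ i → toHom (φ ⟨$⟩ i) ; cong = Func.cong φ }

        operate : ∀ {I} → Op I → Func I small → Homomorphism 𝕋 (free 𝟙 ⊠ A) B
        operate {I} t φ = copower-elim (homs φ) ∘ extend (free I) (const t) ×id[ A ]

        copower-elim-cong : ∀ {I} (φ φ′ : Func I small) →
          (∀ i → Setoid._≈_ small (φ ⟨$⟩ i) (φ′ ⟨$⟩ i)) →
          ∀ {p p′} → Setoid._≈_ (T I ×ₛ A.X) p p′ →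
          (fun (copower-elim (homs φ)) ⟨$⟩ p) B.≈ (fun (copower-elim (homs φ′)) ⟨$⟩ p′)
        copower-elim-cong φ φ′ φ≈ {t , a} q =
          BX.trans (BP.⟦⟧-congʳ (λ i → φ≈ i (unaryPart t , a))) (Func.cong (fun (copower-elim (homs φ′))) q)

      exponentialModel : Model 𝕋
      exponentialModel = record
        { X       = small
        ; actFn   = λ I → record
          { to   = λ (t , φ) → ofHom (operate t φ)
          ; cong = λ {(t , φ)} {(t′ , φ′)} (p , q) (n , a) → copower-elim-cong φ φ′ q
                     (⟪⟫-cong (Setoid.refl (T 𝟙)) (λ _ → p) , Setoid.refl A.X)
          }
        ; ⟦proj⟧  = λ i φ (n , a) → copower-elim-β (homs φ) i n a
        -- After `n(t(u))` is reassociated to `(n(t))(u)`, decomposing `n(t)` gives the action of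
        -- `t` on the family of the uᵢ acting on `φ`.
        ; ⟦subst⟧ = λ {I} {J} t u φ (n , a) → BX.trans
            (Func.cong (fun (copower-elim (homs φ)))
              (Setoid.sym (T J) (Setoid.trans (T J) (subst-subst n (const t) u)
                (⟪⟫-cong (Setoid.refl (T 𝟙)) (λ _ → Setoid.refl (T J))))
              , Setoid.refl A.X))
            (decomposeˡ (free J) (copower-elim (homs φ)) (n ⟪ const t ⟫) u a _ (λ i → BX.refl))
        }

      evaluation : Homomorphism 𝕋 (exponentialModel ⊠ A) B
      evaluation = record
        { fun       = record
          { to   = λ (φ , a) → proj₁ φ ⟨$⟩ (x , a)
          ; cong = λ {(φ , a)} {(φ′ , a′)} (p , q) →
              BX.trans (p (x , a)) (Func.cong (proj₁ φ′) (Setoid.refl (T 𝟙) , q))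
          }
        ; preserves = λ {I} t w → preserving t (Composition.function w (fun (Product.π₁ P)))
                                               (Composition.function w (fun (Product.π₂ P)))
        }
        where
        P = productModel exponentialModel A

        preserving : ∀ {I} (t : Op I) (φ : Func I small) (a : Func I A.X) →
          (fun (copower-elim (homs φ)) ⟨$⟩ (x ⟪ const t ⟫ , A.⟦ t ⟧ a)) B.≈
          B.⟦ t ⟧ (record
            { to   = λ i → proj₁ (φ ⟨$⟩ i) ⟨$⟩ (x , a ⟨$⟩ i)
            ; cong = λ {i} {j} p → BX.trans (Func.cong φ p (x , a ⟨$⟩ i))
                (Func.cong (proj₁ (φ ⟨$⟩ j)) (Setoid.refl (T 𝟙) , Func.cong a p))
            })
        preserving {I} t φ a = begin⟨ BX ⟩
          fun (copower-elim (homs φ)) ⟨$⟩ (x ⟪ const t ⟫ , A.⟦ t ⟧ a)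
            -- Writing `t` as `t ⟪ proj I ⟫` makes the pair a value of `t` in `free I ⊠ A`.
            ≈⟨ Func.cong (fun (copower-elim (homs φ)))
                 ( Setoid.trans (T I) (proj-subst tt _) (Setoid.sym (T I) (subst-proj t))
                 , Setoid.refl A.X) ⟩
          fun (copower-elim (homs φ)) ⟨$⟩ (t ⟪ proj I ⟫ , A.⟦ t ⟧ a)
            ≈⟨ preserves (copower-elim (homs φ)) t args ⟩
          B.⟦ t ⟧ (Composition.function args (fun (copower-elim (homs φ))))
            ≈⟨ BP.⟦⟧-congʳ (λ i → BX.trans
                 (Func.cong (fun (copower-elim (homs φ)))
                   (Setoid.sym (T I) (generic-incl I i) , Setoid.refl A.X))
                 (copower-elim-β (homs φ) i x (a ⟨$⟩ i))) ⟩
          B.⟦ t ⟧ _ ∎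
          where
          args : Func I (T I ×ₛ A.X)
          args = record
            { to   = λ i → π i , a ⟨$⟩ i
            ; cong = λ p → Func.cong (proj I) p , Func.cong a p
            }

      module _ (C : Model 𝕋) (g : Homomorphism 𝕋 (C ⊠ A) B) where
        private
          module C = Model C
          module CP = ModelProperties C

        -- Same formula as for sets with a monoid action, the monoid being that of unary operations:
        -- `c` goes to `(n , a) ↦ g(n(c) , a)`.
        transposeHom : Homomorphism 𝕋 C exponentialModel
        transposeHom = record
          { fun       = record
            { to   = λ c → ofHom (g ∘ extend C (const c) ×id[ A ])
            ; cong = λ p (n , a) → Func.cong (fun g) (CP.⟦⟧-congʳ (λ _ → p) , Setoid.refl A.X)
            }
          ; preserves = λ {I} t c (n , a) → BX.trans
              (Func.cong (fun g)
                (Setoid.sym C.X (Setoid.trans C.X (C.⟦subst⟧ n (const t) c)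
                  (CP.⟦⟧-congʳ (λ _ → Setoid.refl C.X)))
                , Setoid.refl A.X))
              (decomposeˡ C g (n ⟪ const t ⟫) c a _ (λ i → BX.refl))
          }

        -- The value of `k c` at `(n , a)` is that of `n` acting on `k c`, taken at `(x , a)`. As
        -- `k` preserves `n`, the values at `x` determine `k`.
        transposeHom-unique : (k : Homomorphism 𝕋 C exponentialModel) →
          (∀ ((c , a) : Carrier C.X × Carrier A.X) →
             (proj₁ (fun k ⟨$⟩ c) ⟨$⟩ (x , a)) B.≈ (fun g ⟨$⟩ (c , a))) →
          Setoid._≈_ (HomSetoid 𝕋 C exponentialModel) k transposeHom
        transposeHom-unique k k≈g c (n , a) = BX.sym (begin⟨ BX ⟩
          fun g ⟨$⟩ (C.⟦ n ⟧ (const c) , a)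
            ≈⟨ k≈g (C.⟦ n ⟧ (const c) , a) ⟨
          proj₁ (fun k ⟨$⟩ C.⟦ n ⟧ (const c)) ⟨$⟩ (x , a)
            ≈⟨ preserves k n (const c) (x , a) ⟩
          fun (copower-elim (homs kc)) ⟨$⟩ (x ⟪ const n ⟫ , a)
            ≈⟨ Func.cong (fun (copower-elim (homs kc)))
                 (Setoid.trans (T 𝟙) (proj-subst tt _) (Setoid.sym (T 𝟙) (π-generic n))
                 , Setoid.refl A.X) ⟩
          fun (copower-elim (homs kc)) ⟨$⟩ (n ⟪ const x ⟫ , a)
            ≈⟨ copower-elim-β (homs kc) tt n a ⟩
          proj₁ (fun k ⟨$⟩ c) ⟨$⟩ (n , a) ∎)
          where
          kc : Func 𝟙 small
          kc = Composition.function (const c) (fun k)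

      exponential : Exponential (Mod 𝕋) productModel A B
      exponential = record
        { B^A    = exponentialModel
        ; eval   = evaluation
        ; curry  = λ {C} → transposeHom C
        ; β      = λ {C} g (c , a) → Func.cong (fun g) (Model.⟦proj⟧ C tt (const c) , Setoid.refl A.X)
        ; unique = λ {C} → transposeHom-unique C
        }

    cartesianClosed : CartesianClosed (Mod 𝕋)
    cartesianClosed = record
      { terminal    = terminalModel
      ; product     = productModel
      ; exponential = exponential
      }

theorem5p5 : ∀ {ℓ} (𝕋 : Theory ℓ) → CartesianClosed (Mod 𝕋) ⇔ IsHyperaffineUnary 𝕋
theorem5p5 𝕋 = mk⇔
  (λ ccc → let open CartesianClosed ccc in
     FromExponentials.isHyperaffineUnary
       (λ A B → changeProduct (Mod 𝕋) product productModel (exponential A B)))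
  (λ decompose → FromDecompositions.cartesianClosed decompose)
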